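{- Let $u,w\in\mathfrak{W}_n$. If $\mathcal{Q}(u)=\mathcal{Q}(w)$, then $u\sim_{cd}w$.
   Context: $\mathfrak{W}_n$: words of length $n$ in positive integers. For a word $x$, $\mathrm{lds}(x)$ is the length of a longest strictly decreasing subsequence; $u\sim_{cd}w$ means $\mathrm{lds}(u_i\cdots u_j)=\mathrm{lds}(w_i\cdots w_j)$ for all $1\le i\le j\le n$. iRSK: for a one-row semistandard tableau $p$ and integer $a$, $p\dashleftarrow a$ appends $a$ if $p$ is empty or $a\ge$ all entries of $p$, otherwise replaces the leftmost entry larger than $a$ by $a$ (bumping it); for a word, insert letters successively. For a semistandard tableau $P'$ with rows $p'_1,p'_2,\dots$ and positive integer $a$, $P'\twoheadleftarrow a$: adjoin a row $p'_0$ consisting of one box containing $a$, above row $1$, in the column just right of the last box of $p'_1$; $S_0=\{a\}$. Given $S_i=\{a_1<\dots<a_k\}$, let $\alpha_i^+=a_1^{m_1}\cdots a_k^{m_k}$ ($m_j\ge1$) be chosen so that in $p_{i+1}:=p'_{i+1}\dashleftarrow\alpha_i^+$ the rightmost occurrence of each $a_j$ is in the same column as the leftmost occurrence of $a_j$ in $p'_i$; $S_{i+1}$ is the set of bumped values; stop when it is empty (remaining rows unchanged). The result has rows $p_1,p_2,\dots$. $\mathcal{P}(w)=((\emptyset\twoheadleftarrow w_1)\twoheadleftarrow w_2)\cdots\twoheadleftarrow w_n$. With $\lambda^{(j)}$ the shape of $\mathcal{P}(w_1\cdots w_j)$ and $\lambda^{(0)}=\emptyset$, the i-recording tableau $\mathcal{Q}(w)$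 is the tableau of shape $\lambda^{(n)}$ with entry $j$ in each box of $\lambda^{(j)}/\lambda^{(j-1)}$, $1\le j\le n$. -}

module Defs where

open import Data.Nat using (ℕ; zero; suc; _+_; _∸_; _⊔_; _<ᵇ_; _≡ᵇ_)
open import Data.Bool using (Bool; true; false; if_then_else_; _∧_)
open import Data.List using (List; []; _∷_; _++_; length; map; replicate; foldr; take; drop)
open import Data.Maybe using (Maybe; just; nothing)
open import Data.Product using (_×_; _,_; proj₁; proj₂)
open import Data.Nat using (_≤_; _≟_)
open import Data.List using (deduplicate)
open import Relation.Binary.PropositionalEquality using (_≡_)

-- Words are lists of natural numbers (positivity imposed in the theorem).
Word : Set
Word = List ℕ

subseqs : List ℕ → List (List ℕ)
subseqs [] = [] ∷ []
subseqs (a ∷ x) = map (a ∷_) (subseqs x) ++ subseqs x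

strictDec : List ℕ → Bool
strictDec [] = true
strictDec (a ∷ []) = true
strictDec (a ∷ b ∷ x) = (b <ᵇ a) ∧ strictDec (b ∷ x)

lds : List ℕ → ℕ
lds x = foldr (λ y m → (if strictDec y then length y else 0) ⊔ m) 0 (subseqs x)

-- the factor x_i ⋯ x_j (1-indexed, inclusive)
factor : ℕ → ℕ → List ℕ → List ℕ
factor i j x = take (suc j ∸ i) (drop (i ∸ 1) x)

_∼cd_ : Word → Word → Set
u ∼cd w = ∀ (i j : ℕ) → 1 ≤ i → i ≤ j → j ≤ length u →
          lds (factor i j u) ≡ lds (factor i j w)

-- Row insertion  p ⇠ a  (columns are 0-indexed)

ins1 : ℕ → List ℕ → List ℕ × ℕ × Maybe ℕ
ins1 a [] = (a ∷ [] , 0 , nothing)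
ins1 a (x ∷ r) with a <ᵇ x
... | true  = (a ∷ r , 0 , just x)
... | false with ins1 a r
...   | (r' , p , b) = (x ∷ r' , suc p , b)

maybeList : Maybe ℕ → List ℕ
maybeList nothing  = []
maybeList (just b) = b ∷ []

-- insert a^m into r, with m ≥ 1 chosen so that the last copy of a lands in
-- column c (successive copies of a land in consecutive columns; the fuel
-- bounds m ≤ c + 1). Returns new row and the list of bumped entries.
insRep : ℕ → ℕ → ℕ → List ℕ → List ℕ × List ℕ
insRep a c zero r = (r , [])
insRep a c (suc f) r with ins1 a r
... | (r' , p , b) with p <ᵇ c
...   | true  with insRep a c f r'
...     | (r'' , bs) = (r'' , maybeList b ++ bs)
insRep a c (suc f) r | (r' , p , b) | false = (r' , maybeList b)

-- insert α⁺ = a₁^{m₁}⋯a_k^{m_k}: S given as list of (aⱼ , target column cⱼ)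
-- with a₁ < ⋯ < a_k
insWord : List (ℕ × ℕ) → List ℕ → List ℕ × List ℕ
insWord [] r = (r , [])
insWord ((a , c) ∷ S) r with insRep a c (suc c) r
... | (r' , bs) with insWord S r'
...   | (r'' , bs') = (r'' , bs ++ bs')

leftmost : ℕ → List ℕ → ℕ
leftmost b [] = 0
leftmost b (x ∷ r) = if b ≡ᵇ x then 0 else suc (leftmost b r)

dedup : List ℕ → List ℕ
dedup = deduplicate _≟_

-- a semistandard tableau as its list of (left-justified) rows, top to bottom
Tableau : Set
Tableau = List (List ℕ)

-- S bumped values as a set (bumped entries occur in weakly increasing order),
-- each paired with its leftmost column in the original row
targets : List ℕ → List ℕ → List (ℕ × ℕ)
targets bs row = map (λ b → (b , leftmost b row)) (dedup bs)

bumpRows : List (ℕ × ℕ) → Tableau → Tableau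
bumpRows [] rows = rows
bumpRows (s ∷ S) [] = proj₁ (insWord (s ∷ S) []) ∷ []
bumpRows (s ∷ S) (row ∷ rows) with insWord (s ∷ S) row
... | (row' , bs) = row' ∷ bumpRows (targets bs row) rows

firstRowLength : Tableau → ℕ
firstRowLength [] = 0
firstRowLength (r ∷ _) = length r

-- P' ↞ a : the row p'_0 = [a] sits in the column just right of p'_1
iins : Tableau → ℕ → Tableau
iins P a = bumpRows ((a , firstRowLength P) ∷ []) P

shape : Tableau → List ℕ
shape = map length

addBoxes : ℕ → Tableau → List ℕ → Tableau
addBoxes j [] [] = []
addBoxes j [] (n ∷ ns) = replicate n j ∷ addBoxes j [] ns
addBoxes j (q ∷ qs) [] = q ∷ addBoxes j qs []
addBoxes j (q ∷ qs) (n ∷ ns) = (q ++ replicate (n ∸ length q) j) ∷ addBoxes j qs ns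

iRSKfrom : ℕ → Tableau × Tableau → Word → Tableau × Tableau
iRSKfrom j (P , Q) [] = (P , Q)
iRSKfrom j (P , Q) (a ∷ w) =
  let P' = iins P a in iRSKfrom (suc j) (P' , addBoxes (suc j) Q (shape P')) w

𝒫 : Word → Tableau
𝒫 w = proj₁ (iRSKfrom 0 ([] , []) w)

𝒬 : Word → Tableau
𝒬 w = proj₂ (iRSKfrom 0 ([] , []) w)

{-# OPTIONS --safe #-}

-- A word acts on functions ℕ → ℕ letter by letter (ins, act); applied to zero it gives v ↦ the lds of its
-- subword of letters ≥ v.  This action satisfies the Knuth relations and ins a ∘ ins a = ins a, so pushing
-- the set s into a row r is an identity of operators  r · s = s′ · r′,  s′ being the set bumped out; the
-- columns at which the insertions stop play no role.  Hence the functions depth R k, read off the first k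
-- rows of the i-insertion tableau, follow the lds of the word until the bumping leaves row k, and a row
-- that gets longer ends in the largest value pushed into it.  It follows that lds(w_i ⋯ w_j) is the largest
-- m for which 𝒬 w has entries i ≤ t₁ < ⋯ < tₘ ≤ j lying in rows k₁ < ⋯ < kₘ: a function of 𝒬 w alone.

module Submission where

open import Defs
open import Data.Nat
open import Data.Nat.Properties
open import Data.Bool using (true; false; T; if_then_else_)
open import Data.Bool.Properties using (T-∧)
open import Data.Empty using (⊥; ⊥-elim)
open import Data.List using (List; []; _∷_; _++_; length; map; filter; foldr; foldl; take; drop; replicate)
open import Data.List.Properties using (++-assoc; ++-identityʳ; filter-all; filter-none; filter-reject; filter-++;
  foldl-++; length-++; length-drop; length-replicate; length-take; map-∘; map-id; take-[]; take-take)
open import Data.List.Membership.Propositional using (_∈_)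
open import Data.List.Membership.Propositional.Properties using (∈-++⁻; ∈-++⁺ˡ; ∈-++⁺ʳ; ∈-map⁺; ∈-map⁻; ∈-deduplicate⁺; ∈-deduplicate⁻)
open import Data.List.Relation.Unary.All as All using (All; []; _∷_)
import Data.List.Relation.Unary.All.Properties as All
open import Data.List.Relation.Unary.AllPairs using (AllPairs; []; _∷_)
import Data.List.Relation.Unary.AllPairs.Properties as AllPairs
open import Data.List.Relation.Unary.Any using (here; there)
open import Data.Product using (∃-syntax; _×_; _,_; proj₁; proj₂)
open import Data.Sum using (_⊎_; inj₁; inj₂)
open import Function using (_∘_; Equivalence)
open import Relation.Nullary using (yes; no; ¬_; ¬?; contradiction)
open import Relation.Binary.PropositionalEquality

-- Words acting on functions: order properties

-- Effect of appending the letter a, if f v is the lds of the letters ≥ v so far.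
ins : ℕ → (ℕ → ℕ) → ℕ → ℕ
ins a f v with v ≤? a
... | yes _ = f v ⊔ suc (f (suc a))
... | no  _ = f v

act : List ℕ → (ℕ → ℕ) → ℕ → ℕ
act []      f = f
act (a ∷ x) f = act x (ins a f)

zeros : ℕ → ℕ
zeros _ = 0

Antitone : (ℕ → ℕ) → Set
Antitone f = ∀ {v w} → v ≤ w → f w ≤ f v

_≼_ : (ℕ → ℕ) → (ℕ → ℕ) → Set
f ≼ g = ∀ v → f v ≤ g v

ins-≤ : ∀ {a f v} → v ≤ a → ins a f v ≡ f v ⊔ suc (f (suc a))
ins-≤ {a} {f} {v} v≤a with v ≤? a
... | yes _  = refl
... | no v≰a = contradiction v≤a v≰a

ins-> : ∀ {a f v} → a < v → ins a f v ≡ f v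
ins-> {a} {f} {v} a<v with v ≤? a
... | yes v≤a = contradiction v≤a (<⇒≱ a<v)
... | no _    = refl

ins-cong : ∀ a {f g} → f ≗ g → ins a f ≗ ins a g
ins-cong a f≗g v with v ≤? a
... | yes _ = cong₂ (λ m n → m ⊔ suc n) (f≗g v) (f≗g (suc a))
... | no _  = f≗g v

ins-mono : ∀ a {f g} → f ≼ g → ins a f ≼ ins a g
ins-mono a f≼g v with v ≤? a
... | yes _ = ⊔-mono-≤ (f≼g v) (s≤s (f≼g (suc a)))
... | no _  = f≼g v

ins-increasing : ∀ a f → f ≼ ins a f
ins-increasing a f v with v ≤? a
... | yes _ = m≤m⊔n _ _
... | no _  = ≤-refl

ins-step : ∀ {a f v} → v ≤ a → suc (f (suc a)) ≤ ins a f v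
ins-step {a} {f} {v} v≤a = subst (suc (f (suc a)) ≤_) (sym (ins-≤ v≤a)) (m≤n⊔m (f v) _)

ins-antitone : ∀ a {f} → Antitone f → Antitone (ins a f)
ins-antitone a {f} anti {v} {w} v≤w with v ≤? a | w ≤? a
... | yes _   | yes _   = ⊔-monoˡ-≤ _ (anti v≤w)
... | yes _   | no _    = m≤n⇒m≤n⊔o _ (anti v≤w)
... | no v≰a  | yes w≤a = contradiction (≤-trans v≤w w≤a) v≰a
... | no _    | no _    = anti v≤w

act-cong : ∀ x {f g} → f ≗ g → act x f ≗ act x g
act-cong []      f≗g = f≗g
act-cong (a ∷ x) f≗g = act-cong x (ins-cong a f≗g)

act-mono : ∀ x {f g} → f ≼ g → act x f ≼ act x g
act-mono []      f≼g = f≼g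
act-mono (a ∷ x) f≼g = act-mono x (ins-mono a f≼g)

act-increasing : ∀ x f → f ≼ act x f
act-increasing []      f v = ≤-refl
act-increasing (a ∷ x) f v = ≤-trans (ins-increasing a f v) (act-increasing x (ins a f) v)

act-antitone : ∀ x {f} → Antitone f → Antitone (act x f)
act-antitone []      anti = anti
act-antitone (a ∷ x) anti = act-antitone x (ins-antitone a anti)

act-++ : ∀ x y f → act (x ++ y) f ≡ act y (act x f)
act-++ []      y f = refl
act-++ (a ∷ x) y f = act-++ x y (ins a f)

act-∈ : ∀ {x a} f {v} → Antitone f → a ∈ x → v ≤ a → suc (f (suc a)) ≤ act x f v
act-∈ {a ∷ x} f anti (here refl) v≤a = ≤-trans (ins-step v≤a) (act-increasing x _ _)
act-∈ {b ∷ x} f anti (there a∈x) v≤a =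
  ≤-trans (s≤s (ins-increasing b f _)) (act-∈ (ins b f) (ins-antitone b anti) a∈x v≤a)

act-beyond : ∀ {x v} f → All (_< v) x → act x f v ≡ f v
act-beyond f []           = refl
act-beyond f (a<v ∷ x<v) = trans (act-beyond _ x<v) (ins-> a<v)

-- Idempotence and Knuth relations of the action

ins-idem : ∀ a f → ins a (ins a f) ≗ ins a f
ins-idem a f v with v ≤? a in eq
... | no _ rewrite eq = refl
... | yes v≤a rewrite eq | ins-> {a} {f} (n<1+n a) =
  trans (⊔-assoc (f v) _ _) (cong (f v ⊔_) (⊔-idem (suc (f (suc a)))))

ins-comm-above : ∀ {x z v} g → x < z → x < v → ins z (ins x g) v ≡ ins x (ins z g) v
ins-comm-above {x} {z} {v} g x<z x<v = trans drop-x (sym (ins-> x<v))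
  where
  drop-x : ins z (ins x g) v ≡ ins z g v
  drop-x with v ≤? z
  ... | yes _ = cong₂ (λ m n → m ⊔ suc n) (ins-> x<v) (ins-> (m<n⇒m<1+n x<z))
  ... | no _  = ins-> x<v

ins-ins-below : ∀ {x z v} g → x < z → v ≤ x →
                ins z (ins x g) v ≡ (g v ⊔ suc (g (suc x))) ⊔ suc (g (suc z))
ins-ins-below g x<z v≤x = trans (ins-≤ (≤-trans v≤x (<⇒≤ x<z)))
  (cong₂ (λ m n → m ⊔ suc n) (ins-≤ v≤x) (ins-> (m<n⇒m<1+n x<z)))

ins-ins-below′ : ∀ {x z v} g → x < z → v ≤ x →
                 ins x (ins z g) v ≡ (g v ⊔ suc (g (suc z))) ⊔ suc (g (suc x) ⊔ suc (g (suc z)))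
ins-ins-below′ g x<z v≤x = trans (ins-≤ v≤x)
  (cong₂ (λ m n → m ⊔ suc n) (ins-≤ (≤-trans v≤x (<⇒≤ x<z))) (ins-≤ x<z))

-- Only the order `z`, `x` lets both letters be used, as a decreasing pair. The gap makes this pair
-- worth no more than `x` alone on top of `g (suc x)`.
ins-comm : ∀ {x z} g → x < z → suc (g (suc z)) ≤ g (suc x) →
           ins z (ins x g) ≗ ins x (ins z g)
ins-comm {x} {z} g x<z gap v with <-≤-connex x v
... | inj₁ x<v = ins-comm-above g x<z x<v
... | inj₂ v≤x = begin
  ins z (ins x g) v                                            ≡⟨ ins-ins-below g x<z v≤x ⟩
  (g v ⊔ suc (g (suc x))) ⊔ suc (g (suc z))                    ≡⟨ ⊔-assoc (g v) _ _ ⟩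
  g v ⊔ (suc (g (suc x)) ⊔ suc (g (suc z)))                    ≡⟨ cong (g v ⊔_) (⊔-comm (suc (g (suc x))) (suc (g (suc z)))) ⟩
  g v ⊔ (suc (g (suc z)) ⊔ suc (g (suc x)))                    ≡⟨ ⊔-assoc (g v) _ _ ⟨
  (g v ⊔ suc (g (suc z))) ⊔ suc (g (suc x))                    ≡⟨ cong (λ m → (g v ⊔ suc (g (suc z))) ⊔ suc m) (m≥n⇒m⊔n≡m gap) ⟨
  (g v ⊔ suc (g (suc z))) ⊔ suc (g (suc x) ⊔ suc (g (suc z)))  ≡⟨ ins-ins-below′ g x<z v≤x ⟨
  ins x (ins z g) v                                            ∎
  where open ≡-Reasoning

-- The letter `y` read first, strictly above `x` and not above `z`, supplies the gap that `ins-comm`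
-- asks for.
knuth₂ : ∀ {x y z f} → x < y → y ≤ z → Antitone f →
         act (y ∷ x ∷ z ∷ []) f ≗ act (y ∷ z ∷ x ∷ []) f
knuth₂ {x} {y} {z} {f} x<y y≤z anti = ins-comm (ins y f) (<-≤-trans x<y y≤z) (begin
  suc (ins y f (suc z)) ≡⟨ cong suc (ins-> (s≤s y≤z)) ⟩
  suc (f (suc z))       ≤⟨ s≤s (anti (s≤s y≤z)) ⟩
  suc (f (suc y))       ≤⟨ ins-step x<y ⟩
  ins y f (suc x)       ∎)
  where open ≤-Reasoning

private
  -- In `knuth₁`, `q`, `r` and `s` are the values of `x`, `z` and `y` taken alone over `f`, and
  -- `suc r` is that of a pair starting with `z`.
  absorb : ∀ p q r s → ((p ⊔ q) ⊔ r) ⊔ (s ⊔ suc r) ≡ ((p ⊔ r) ⊔ (q ⊔ suc r)) ⊔ (s ⊔ suc r)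
  absorb p q r s = ≤-antisym
    (⊔-monoˡ-≤ (s ⊔ suc r) (⊔-lub (⊔-lub p≤ q≤) r≤))
    (⊔-lub (⊔-lub (⊔-lub (m≤n⇒m≤n⊔o (s ⊔ suc r) p≤′) (m≤n⇒m≤n⊔o (s ⊔ suc r) r≤′))
                  (⊔-lub (m≤n⇒m≤n⊔o (s ⊔ suc r) q≤′) r+1≤))
           (m≤n⊔m ((p ⊔ q) ⊔ r) (s ⊔ suc r)))
    where
    p≤ : p ≤ (p ⊔ r) ⊔ (q ⊔ suc r)
    p≤ = ≤-trans (m≤m⊔n p r) (m≤m⊔n _ _)
    q≤ : q ≤ (p ⊔ r) ⊔ (q ⊔ suc r)
    q≤ = ≤-trans (m≤m⊔n q (suc r)) (m≤n⊔m (p ⊔ r) _)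
    r≤ : r ≤ (p ⊔ r) ⊔ (q ⊔ suc r)
    r≤ = ≤-trans (m≤n⊔m p r) (m≤m⊔n _ _)
    p≤′ : p ≤ (p ⊔ q) ⊔ r
    p≤′ = ≤-trans (m≤m⊔n p q) (m≤m⊔n _ _)
    q≤′ : q ≤ (p ⊔ q) ⊔ r
    q≤′ = ≤-trans (m≤n⊔m p q) (m≤m⊔n _ _)
    r≤′ : r ≤ (p ⊔ q) ⊔ r
    r≤′ = m≤n⊔m (p ⊔ q) r
    r+1≤ : suc r ≤ ((p ⊔ q) ⊔ r) ⊔ (s ⊔ suc r)
    r+1≤ = m≤n⇒m≤o⊔n ((p ⊔ q) ⊔ r) (m≤n⊔m s (suc r))

-- For `v ≤ x` the extra decreasing pair `z`, `x` on the right is matched by the pair `z`, `y` on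
-- both sides; for `v > x` the letter `x` changes nothing.
knuth₁ : ∀ {x y z} f → x ≤ y → y < z →
         act (x ∷ z ∷ y ∷ []) f ≗ act (z ∷ x ∷ y ∷ []) f
knuth₁ {x} {y} {z} f x≤y y<z v with <-≤-connex x v
... | inj₁ x<v = ins-cong-at v (ins-comm-above f x<z x<v)
  where
  x<z : x < z
  x<z = ≤-<-trans x≤y y<z
  ins-cong-at : ∀ v → ins z (ins x f) v ≡ ins x (ins z f) v →
                ins y (ins z (ins x f)) v ≡ ins y (ins x (ins z f)) v
  ins-cong-at v eq with v ≤? y
  ... | yes _ = cong₂ (λ m n → m ⊔ suc n) eq (ins-comm-above f x<z (s≤s x≤y))
  ... | no _  = eq
... | inj₂ v≤x = begin
  ins y (ins z (ins x f)) v
    ≡⟨ ins-≤ (≤-trans v≤x x≤y) ⟩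
  ins z (ins x f) v ⊔ suc (ins z (ins x f) (suc y))
    ≡⟨ cong₂ (λ m n → m ⊔ suc n) (ins-ins-below f x<z v≤x)
             (trans (ins-comm-above f x<z (s≤s x≤y)) above) ⟩
  ((f v ⊔ suc (f (suc x))) ⊔ suc (f (suc z))) ⊔ suc (f (suc y) ⊔ suc (f (suc z)))
    ≡⟨ absorb (f v) (suc (f (suc x))) (suc (f (suc z))) (suc (f (suc y))) ⟩
  ((f v ⊔ suc (f (suc z))) ⊔ suc (f (suc x) ⊔ suc (f (suc z)))) ⊔ suc (f (suc y) ⊔ suc (f (suc z)))
    ≡⟨ cong₂ (λ m n → m ⊔ suc n) (ins-ins-below′ f x<z v≤x) above ⟨
  ins x (ins z f) v ⊔ suc (ins x (ins z f) (suc y))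
    ≡⟨ ins-≤ (≤-trans v≤x x≤y) ⟨
  ins y (ins x (ins z f)) v ∎
  where
  open ≡-Reasoning
  x<z : x < z
  x<z = ≤-<-trans x≤y y<z
  above : ins x (ins z f) (suc y) ≡ f (suc y) ⊔ suc (f (suc z))
  above = trans (ins-> (s≤s x≤y)) (ins-≤ y<z)

-- Row insertion as inductive relations

Sorted : List ℕ → Set
Sorted = AllPairs _≤_

data Bump (a : ℕ) : List ℕ → List ℕ → List ℕ → Set where
  app  : Bump a [] (a ∷ []) []
  hit  : ∀ {x r} → a < x → Bump a (x ∷ r) (a ∷ r) (x ∷ [])
  skip : ∀ {x r r′ b} → x ≤ a → Bump a r r′ b → Bump a (x ∷ r) (x ∷ r′) b

-- The number m ≥ 1 of copies of `a` is left free, so that a statement about `Many` covers every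
-- choice made by `insRep`.
data Many (a : ℕ) : List ℕ → List ℕ → List ℕ → Set where
  one  : ∀ {r r′ b} → Bump a r r′ b → Many a r r′ b
  more : ∀ {r r₁ r′ b bs} → Bump a r r₁ b → Many a r₁ r′ bs → Many a r r′ (b ++ bs)

data Insert : List ℕ → List ℕ → List ℕ → List ℕ → Set where
  []  : ∀ {r} → Insert [] r r []
  _∷_ : ∀ {a s r r₁ r′ b bs} → Many a r r₁ b → Insert s r₁ r′ bs → Insert (a ∷ s) r r′ (b ++ bs)

module _ {a : ℕ} where

  -- The Knuth relations carry the new letter leftwards to its place (`slide`, by `knuth₂`), then
  -- the bumped letter leftwards past the entries before it (`swap`, by `knuth₁`).
  bump-act : ∀ {r r′ b f} → Sorted r → Antitone f → Bump a r r′ b →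
             act (r ++ a ∷ []) f ≗ act (b ++ r′) f
  bump-act _        _    app _ = refl
  bump-act (x≤r ∷ sr) anti (hit a<x) v = slide sr x≤r a<x anti v
    where
    slide : ∀ {r x f} → Sorted r → All (x ≤_) r → a < x → Antitone f →
            act (r ++ a ∷ []) (ins x f) ≗ act (a ∷ r) (ins x f)
    slide [] [] _ _ _ = refl
    slide {y ∷ r} {x} {f} (y≤r ∷ sr) (x≤y ∷ _) a<x anti v = trans
      (slide sr y≤r (<-≤-trans a<x x≤y) (ins-antitone x anti) v)
      (sym (act-cong r (knuth₂ a<x x≤y anti) v))
  bump-act {x ∷ r} {_ ∷ r′} {b} {f} (x≤r ∷ sr) anti (skip x≤a p) v = trans
    (bump-act sr (ins-antitone x anti) p v) (swap p x≤r v)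
    where
    swap : ∀ {r r′ b} → Bump a r r′ b → All (x ≤_) r → act (b ++ r′) (ins x f) ≗ act (b ++ x ∷ r′) f
    swap app _ _ = refl
    swap {r′ = _ ∷ r′} (hit a<y) _ v = act-cong r′ (knuth₁ f x≤a a<y) v
    swap {r′ = _ ∷ r′} {b = []} (skip _ _) _ _ = refl
    swap {r′ = y ∷ r′} {b = z ∷ _} (skip y≤a p) (x≤y ∷ _) v with bumped p
      where
      bumped : ∀ {r r′ z b} → Bump a r r′ (z ∷ b) → a < z × b ≡ []
      bumped (hit a<x)  = a<x , refl
      bumped (skip _ p) = bumped p
    ... | a<z , refl = act-cong r′ (knuth₁ f x≤y (≤-<-trans y≤a a<z)) v

  bump-All : ∀ {r r′ b} {P : ℕ → Set} → Bump a r r′ b → All P r → P a → All P r′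
  bump-All app        _          pa = pa ∷ []
  bump-All (hit _)    (_ ∷ pr)  pa = pa ∷ pr
  bump-All (skip _ p) (px ∷ pr) pa = px ∷ bump-All p pr pa

  bump-sorted : ∀ {r r′ b} → Sorted r → Bump a r r′ b → Sorted r′
  bump-sorted _ app = [] ∷ []
  bump-sorted (x≤r ∷ sr) (hit a<x) = All.map (≤-trans (<⇒≤ a<x)) x≤r ∷ sr
  bump-sorted (x≤r ∷ sr) (skip x≤a p) = bump-All p x≤r x≤a ∷ bump-sorted sr p

  -- A bumped letter was an entry of `r` larger than `a`; quantifying over `P` delivers both facts
  -- at once.
  bump-bumped : ∀ {r r′ b} {P : ℕ → Set} → Bump a r r′ b →
                All (λ x → a < x → P x) r → All P b
  bump-bumped app        _        = []
  bump-bumped (hit a<x)  (p ∷ _)  = p a<x ∷ []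
  bump-bumped (skip _ q) (_ ∷ ps) = bump-bumped q ps

  bump-length : ∀ {r r′ b} → Bump a r r′ b → length r ≤ length r′
  bump-length app        = z≤n
  bump-length (hit _)    = ≤-refl
  bump-length (skip _ p) = s≤s (bump-length p)

  bump-grown : ∀ {r r′ b} → Bump a r r′ b → length r < length r′ → All (_≤ a) r′
  bump-grown app          _         = ≤-refl ∷ []
  bump-grown (hit _)      n<n       = ⊥-elim (<-irrefl refl n<n)
  bump-grown (skip x≤a p) (s≤s n<m) = x≤a ∷ bump-grown p n<m

  bump-stuck : ∀ {r r′ b} → Bump a r r′ b → length r′ ≤ length r → ∃[ z ] z ∈ b × a < z
  bump-stuck (hit a<x)  _       = _ , here refl , a<x
  bump-stuck (skip _ p) (s≤s l) = bump-stuck p l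

  bump-∈ : ∀ {r r′ b} → Bump a r r′ b → a ∈ r′
  bump-∈ app        = here refl
  bump-∈ (hit _)    = here refl
  bump-∈ (skip _ p) = there (bump-∈ p)

  bump-keeps : ∀ {r r′ b x} → Bump a r r′ b → x ≤ a → x ∈ r → x ∈ r′
  bump-keeps (hit a<x)  x≤a (here refl) = ⊥-elim (<⇒≱ a<x x≤a)
  bump-keeps (hit _)    _   (there x∈r) = there x∈r
  bump-keeps (skip _ _) _   (here refl) = here refl
  bump-keeps (skip _ p) x≤a (there x∈r) = there (bump-keeps p x≤a x∈r)

  -- The leftmost entry above `a` is bumped, and in a sorted row the other entries above `a` are at
  -- least as large. This makes successive bumped values increase weakly.
  bump-above : ∀ {r r′ b} → Sorted r → Bump a r r′ b →
               All (λ z → All (λ x → a < x → z ≤ x) r′) b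
  bump-above _ app = []
  bump-above (x≤r ∷ _) (hit _) = ((λ a<a → ⊥-elim (<-irrefl refl a<a)) ∷ All.map (λ x≤y _ → x≤y) x≤r) ∷ []
  bump-above (_ ∷ sr) (skip x≤a p) = All.map ((λ a<x → ⊥-elim (<⇒≱ a<x x≤a)) ∷_) (bump-above sr p)

  many-All : ∀ {r r′ bs} {P : ℕ → Set} → Many a r r′ bs → All P r → P a → All P r′
  many-All (one p)    pr pa = bump-All p pr pa
  many-All (more p q) pr pa = many-All q (bump-All p pr pa) pa

  many-sorted : ∀ {r r′ bs} → Sorted r → Many a r r′ bs → Sorted r′
  many-sorted sr (one p)    = bump-sorted sr p
  many-sorted sr (more p q) = many-sorted (bump-sorted sr p) q

  -- Further copies of a act trivially, so bumping with any positive number of them is sound.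
  many-act : ∀ {r r′ bs f} → Sorted r → Antitone f → Many a r r′ bs →
             act (r ++ a ∷ []) f ≗ act (bs ++ r′) f
  many-act sr anti (one p) = bump-act sr anti p
  many-act {r} {r′} {f = f} sr anti (more {r₁ = r₁} {b = b} {bs = bs} p q) v = begin
    act (r ++ a ∷ []) f v                ≡⟨ cong-app (act-++ r (a ∷ []) f) v ⟩
    ins a (act r f) v                    ≡⟨ ins-idem a (act r f) v ⟨
    ins a (ins a (act r f)) v            ≡⟨ ins-cong a (cong-app (act-++ r (a ∷ []) f)) v ⟨
    ins a (act (r ++ a ∷ []) f) v        ≡⟨ ins-cong a (bump-act sr anti p) v ⟩
    ins a (act (b ++ r₁) f) v            ≡⟨ ins-cong a (cong-app (act-++ b r₁ f)) v ⟩
    ins a (act r₁ (act b f)) v           ≡⟨ cong-app (act-++ r₁ (a ∷ []) (act b f)) v ⟨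
    act (r₁ ++ a ∷ []) (act b f) v       ≡⟨ many-act (bump-sorted sr p) (act-antitone b anti) q v ⟩
    act (bs ++ r′) (act b f) v           ≡⟨ cong-app (act-++ b (bs ++ r′) f) v ⟨
    act (b ++ bs ++ r′) f v              ≡⟨ cong (λ x → act x f v) (++-assoc b bs r′) ⟨
    act ((b ++ bs) ++ r′) f v            ∎
    where open ≡-Reasoning

  vacuous : ∀ {P : ℕ → Set} → a < a → P a
  vacuous a<a = ⊥-elim (<-irrefl refl a<a)

  many-bumped : ∀ {r r′ bs} {P : ℕ → Set} → Many a r r′ bs →
                All (λ x → a < x → P x) r → All P bs
  many-bumped (one p) pr = bump-bumped p pr
  many-bumped {P = P} (more p q) pr =
    All.++⁺ (bump-bumped p pr) (many-bumped q (bump-All p pr (vacuous {P})))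

  many-length : ∀ {r r′ bs} → Many a r r′ bs → length r ≤ length r′
  many-length (one p)    = bump-length p
  many-length (more p q) = ≤-trans (bump-length p) (many-length q)

  many-grown : ∀ {r r′ bs} → Many a r r′ bs → length r < length r′ → All (_≤ a) r′
  many-grown (one p) l = bump-grown p l
  many-grown (more {r} {r₁} p q) l with length r <? length r₁
  ... | yes l₁ = many-All q (bump-grown p l₁) ≤-refl
  ... | no ¬l₁ = many-grown q (≤-<-trans (≮⇒≥ ¬l₁) l)

  many-stuck : ∀ {r r′ bs} → Many a r r′ bs → length r′ ≤ length r → ∃[ z ] z ∈ bs × a < z
  many-stuck (one p)    l = bump-stuck p l
  many-stuck (more p q) l with bump-stuck p (≤-trans (many-length q) l)
  ... | z , z∈b , a<z = z , ∈-++⁺ˡ z∈b , a<z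

  many-∈ : ∀ {r r′ bs} → Many a r r′ bs → a ∈ r′
  many-∈ (one p)    = bump-∈ p
  many-∈ (more _ q) = many-∈ q

  many-keeps : ∀ {r r′ bs x} → Many a r r′ bs → x ≤ a → x ∈ r → x ∈ r′
  many-keeps (one p)    x≤a x∈r = bump-keeps p x≤a x∈r
  many-keeps (more p q) x≤a x∈r = many-keeps q x≤a (bump-keeps p x≤a x∈r)

  many-above : ∀ {r r′ bs} → Sorted r → Many a r r′ bs →
               All (λ z → All (λ x → a < x → z ≤ x) r′) bs
  many-above sr (one p) = bump-above sr p
  many-above sr (more p q) = All.++⁺
    (All.map (λ {z} h → many-All q h (vacuous {z ≤_})) (bump-above sr p))
    (many-above (bump-sorted sr p) q)

  many-bumped-sorted : ∀ {r r′ bs} → Sorted r → Many a r r′ bs → Sorted bs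
  many-bumped-sorted sr (one p) = single p
    where
    single : ∀ {r r′ b} → Bump a r r′ b → Sorted b
    single app        = []
    single (hit _)    = [] ∷ []
    single (skip _ p) = single p
  many-bumped-sorted sr (more p q) = AllPairs.++⁺
    (many-bumped-sorted sr (one p)) (many-bumped-sorted (bump-sorted sr p) q)
    (All.map (many-bumped q) (bump-above sr p))

insert-All : ∀ {s r r′ bs} {P : ℕ → Set} → Insert s r r′ bs → All P r → All P s → All P r′
insert-All []      pr _         = pr
insert-All (p ∷ q) pr (pa ∷ ps) = insert-All q (many-All p pr pa) ps

insert-sorted : ∀ {s r r′ bs} → Sorted r → Insert s r r′ bs → Sorted r′
insert-sorted sr []      = sr
insert-sorted sr (p ∷ q) = insert-sorted (many-sorted sr p) q

insert-act : ∀ {s r r′ bs f} → Sorted r → Antitone f → Insert s r r′ bs →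
             act s (act r f) ≗ act r′ (act bs f)
insert-act sr anti [] v = refl
insert-act {a ∷ s} {r} {r′} {f = f} sr anti (_∷_ {r₁ = r₁} {b = b} {bs = bs} p q) v = begin
  act s (ins a (act r f)) v       ≡⟨ act-cong s (cong-app (act-++ r (a ∷ []) f)) v ⟨
  act s (act (r ++ a ∷ []) f) v   ≡⟨ act-cong s (many-act sr anti p) v ⟩
  act s (act (b ++ r₁) f) v       ≡⟨ act-cong s (cong-app (act-++ b r₁ f)) v ⟩
  act s (act r₁ (act b f)) v      ≡⟨ insert-act (many-sorted sr p) (act-antitone b anti) q v ⟩
  act r′ (act bs (act b f)) v     ≡⟨ act-cong r′ (cong-app (act-++ b bs f)) v ⟨
  act r′ (act (b ++ bs) f) v      ∎
  where open ≡-Reasoning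

insert-length : ∀ {s r r′ bs} → Insert s r r′ bs → length r ≤ length r′
insert-length []      = ≤-refl
insert-length (p ∷ q) = ≤-trans (many-length p) (insert-length q)

insert-keeps : ∀ {s r r′ bs x} → Insert s r r′ bs → All (x ≤_) s → x ∈ r → x ∈ r′
insert-keeps []      _           x∈r = x∈r
insert-keeps (p ∷ q) (x≤a ∷ x≤s) x∈r = insert-keeps q x≤s (many-keeps p x≤a x∈r)

insert-∈ : ∀ {s r r′ bs x} → Sorted s → Insert s r r′ bs → x ∈ s → x ∈ r′
insert-∈ (a≤s ∷ _) (p ∷ q) (here refl) = insert-keeps q a≤s (many-∈ p)
insert-∈ (_ ∷ ss)  (p ∷ q) (there x∈s) = insert-∈ ss q x∈s

insert-grown : ∀ {s r r′ bs m} → Insert s r r′ bs → length r < length r′ →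
               All (_≤ m) s → All (_≤ m) r′
insert-grown [] l _ = ⊥-elim (<-irrefl refl l)
insert-grown (_∷_ {r = r} {r₁ = r₁} p q) l (a≤m ∷ s≤m) with length r <? length r₁
... | yes l₁ = insert-All q (All.map (λ x≤a → ≤-trans x≤a a≤m) (many-grown p l₁)) s≤m
... | no ¬l₁ = insert-grown q (≤-<-trans (≮⇒≥ ¬l₁) l) s≤m

-- The last letter of the list, its maximum by sortedness, must bump something too, and this exceeds
-- the whole list.
insert-stuck : ∀ {a s r r′ bs} → Sorted (a ∷ s) → Insert (a ∷ s) r r′ bs →
               length r′ ≤ length r → ∃[ z ] z ∈ bs × All (_< z) (a ∷ s)
insert-stuck {s = []} _ (p ∷ []) l with many-stuck p l
... | z , z∈b , a<z = z , ∈-++⁺ˡ z∈b , a<z ∷ []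
insert-stuck {s = _ ∷ _} ((a≤a′ ∷ _) ∷ ss) (_∷_ {b = b} p q) l
  with insert-stuck ss q (≤-trans l (many-length p))
... | z , z∈bs , s<z@(a′<z ∷ _) = z , ∈-++⁺ʳ b z∈bs , ≤-<-trans a≤a′ a′<z ∷ s<z

insert-below : ∀ {s r r′ bs} → Insert s r r′ bs → All (λ z → ∃[ a ] a ∈ s × a < z) bs
insert-below []      = []
insert-below (p ∷ q) = All.++⁺
  (many-bumped p (All.universal (λ _ a<x → _ , here refl , a<x) _))
  (All.map (λ (a , a∈s , a<z) → a , there a∈s , a<z) (insert-below q))

-- Here `a` serves as a lower bound of `s` and is not inserted itself; every bumped value exceeds
-- it.
insert-bumped : ∀ {a s r r′ bs} {P : ℕ → Set} → Sorted (a ∷ s) → Insert s r r′ bs →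
                All (λ x → a < x → P x) r → All P bs
insert-bumped _ [] _ = []
insert-bumped {P = P} ((a≤a′ ∷ _) ∷ ss) (p ∷ q) pr = All.++⁺
  (many-bumped p pr′) (insert-bumped ss q (many-All p pr′ (λ a′<a′ → ⊥-elim (<-irrefl refl a′<a′))))
  where pr′ = All.map (λ h a′<x → h (≤-<-trans a≤a′ a′<x)) pr

insert-bumped-sorted : ∀ {s r r′ bs} → Sorted s → Sorted r → Insert s r r′ bs → Sorted bs
insert-bumped-sorted _ _ [] = []
insert-bumped-sorted ss@(_ ∷ ss′) sr (p ∷ q) = AllPairs.++⁺
  (many-bumped-sorted sr p) (insert-bumped-sorted ss′ (many-sorted sr p) q)
  (All.map (insert-bumped ss q) (many-above sr p))

insert-[] : ∀ {s r′ bs} → Sorted s → Insert s [] r′ bs → bs ≡ []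
insert-[] _ [] = refl
-- The first letter is doubled to act as the lower bound. The constantly false predicate, vacuous on
-- the empty row, then holds for every bumped value.
insert-[] {bs = bs} ss@(a≤s ∷ _) q = All-⊥ (insert-bumped ((≤-refl ∷ a≤s) ∷ ss) q [])
  where
  All-⊥ : ∀ {xs : List ℕ} → All (λ _ → ⊥) xs → xs ≡ []
  All-⊥ [] = refl
  All-⊥ (() ∷ _)

-- Bumped lists as sets

dedup-sorted : ∀ {x} → Sorted x → Sorted (dedup x)
dedup-sorted [] = []
dedup-sorted {a ∷ _} (a≤x ∷ sx) =
  All.filter⁺ _ (All.deduplicate⁺ _≟_ a≤x) ∷ AllPairs.filter⁺ (¬? ∘ (a ≟_)) (dedup-sorted sx)

-- Equal letters of a sorted word are adjacent, so `ins-idem` absorbs the repetitions.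
dedup-act : ∀ {x} f → Sorted x → act (dedup x) f ≗ act x f
dedup-act {[]} f _ v = refl
dedup-act {a ∷ x} f (a≤x ∷ sx) v = trans
  (skip-a (All.deduplicate⁺ _≟_ a≤x) (dedup-sorted sx) v) (dedup-act (ins a f) sx v)
  where
  skip-a : ∀ {y} → All (a ≤_) y → Sorted y → act (filter (¬? ∘ (a ≟_)) y) (ins a f) ≗ act y (ins a f)
  skip-a [] _ v = refl
  skip-a {b ∷ y} (a≤b ∷ a≤y) (b≤y ∷ sy) v with a ≟ b
  ... | yes refl = trans (cong (λ z → act z (ins a f) v) (filter-reject (¬? ∘ (a ≟_)) (λ a≢a → a≢a refl)))
                         (trans (skip-a a≤y sy v) (sym (act-cong y (ins-idem a f) v)))
  ... | no a≢b   = cong (λ z → act z (ins a f) v)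
    (filter-all (¬? ∘ (a ≟_)) (a≢b ∷ All.map (λ b≤c → <⇒≢ (<-≤-trans (≤∧≢⇒< a≤b a≢b) b≤c)) b≤y))

-- Passing a set of values through one row

-- r, r′: a row before and after; s, s′: the values pushed into it and the values bumped out of it.
record RowStep (r s r′ s′ : List ℕ) : Set where
  field
    sorted-row    : Sorted r′
    sorted-bumped : Sorted s′
    exchange      : ∀ {f} → Antitone f → act s (act r f) ≗ act r′ (act s′ f)
    inserted      : ∀ {x} → x ∈ s → x ∈ r′
    below         : ∀ {z} → z ∈ s′ → ∃[ a ] a ∈ s × a < z
    longer        : length r ≤ length r′
    grown         : ∀ {m} → length r < length r′ → All (_≤ m) s → All (_≤ m) r′
    stuck         : ∀ {a} → a ∈ s → length r′ ≤ length r → ∃[ z ] z ∈ s′ × All (_< z) s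
    from-empty    : r ≡ [] → s′ ≡ []
    quiet         : s ≡ [] → r′ ≡ r

rowStep : ∀ {s r r′ bs} → Sorted s → Sorted r → Insert s r r′ bs → RowStep r s r′ (dedup bs)
rowStep {s} {r} {r′} {bs} ss sr p = record
  { sorted-row    = insert-sorted sr p
  ; sorted-bumped = dedup-sorted bs-sorted
  ; exchange      = λ {f} anti v → trans (insert-act sr anti p v)
                      (sym (act-cong r′ (dedup-act f bs-sorted) v))
  ; inserted      = insert-∈ ss p
  ; below         = λ z∈ → All.lookup (insert-below p) (∈-deduplicate⁻ _≟_ bs z∈)
  ; longer        = insert-length p
  ; grown         = insert-grown p
  ; stuck         = stuck ss p
  ; from-empty    = λ { refl → cong dedup (insert-[] ss p) }
  ; quiet         = λ { refl → quiet p }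
  }
  where
  bs-sorted : Sorted bs
  bs-sorted = insert-bumped-sorted ss sr p
  quiet : ∀ {r r′ bs} → Insert [] r r′ bs → r′ ≡ r
  quiet [] = refl
  stuck : ∀ {a s} → Sorted s → Insert s r r′ bs → a ∈ s → length r′ ≤ length r →
          ∃[ z ] z ∈ dedup bs × All (_< z) s
  stuck {s = _ ∷ _} ss p _ l with insert-stuck ss p l
  ... | z , z∈bs , s<z = z , ∈-deduplicate⁺ _≟_ z∈bs , s<z

-- The algorithm realises the relations

ins1-bump : ∀ a r → let r′ , _ , b = ins1 a r in Bump a r r′ (maybeList b)
ins1-bump a [] = app
ins1-bump a (x ∷ r) with a <ᵇ x in eq
... | true  = hit (<ᵇ⇒< a x (subst T (sym eq) _))
... | false with ins1 a r | ins1-bump a r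
...   | _ , _ , _ | p = skip (≮⇒≥ λ a<x → subst T eq (<⇒<ᵇ a<x)) p

insRep-many : ∀ a c n r → let r′ , bs = insRep a c (suc n) r in Many a r r′ bs
insRep-many a c n r with ins1 a r | ins1-bump a r
... | r₁ , p , b | q with p <ᵇ c
insRep-many a c n       r | r₁ , p , b | q | false = one q
insRep-many a c zero    r | r₁ , p , b | q | true  =
  subst (Many a r r₁) (sym (++-identityʳ (maybeList b))) (one q)
insRep-many a c (suc n) r | r₁ , p , b | q | true with insRep a c (suc n) r₁ | insRep-many a c n r₁
... | _ , _ | q′ = more q q′

insWord-insert : ∀ S r → let r′ , bs = insWord S r in Insert (map proj₁ S) r r′ bs
insWord-insert [] r = []
insWord-insert ((a , c) ∷ S) r with insRep a c (suc c) r | insRep-many a c c r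
... | r₁ , _ | p with insWord S r₁ | insWord-insert S r₁
...   | _ , _ | q = p ∷ q

-- Steps along all rows of a tableau

rowAt : ℕ → Tableau → List ℕ
rowAt _       []      = []
rowAt zero    (r ∷ _) = r
rowAt (suc k) (_ ∷ P) = rowAt k P

-- The set of values pushed into row k, counting rows from 0.
bumped : List (ℕ × ℕ) → Tableau → ℕ → List ℕ
bumped S       P         zero    = map proj₁ S
bumped _       []        (suc k) = []
bumped []      (_ ∷ _)   (suc k) = []
bumped (s ∷ S) (row ∷ P) (suc k) = bumped (targets (proj₂ (insWord (s ∷ S) row)) row) P k

rowAt-sorted : ∀ {P} → All Sorted P → ∀ k → Sorted (rowAt k P)
rowAt-sorted []       _       = []
rowAt-sorted (sr ∷ _) zero    = sr
rowAt-sorted (_ ∷ sP) (suc k) = rowAt-sorted sP k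

rowAt-beyond : ∀ P {k} → length P ≤ k → rowAt k P ≡ []
rowAt-beyond []      _       = refl
rowAt-beyond (_ ∷ P) (s≤s l) = rowAt-beyond P l

targets-values : ∀ bs row → map proj₁ (targets bs row) ≡ dedup bs
targets-values bs row = trans (sym (map-∘ (dedup bs))) (map-id (dedup bs))

idle : ∀ {r} → Sorted r → RowStep r [] r []
idle sr = rowStep [] sr []

bumpRows-rowStep : ∀ S {P} → Sorted (map proj₁ S) → All Sorted P → ∀ k →
  RowStep (rowAt k P) (bumped S P k) (rowAt k (bumpRows S P)) (bumped S P (suc k))
bumpRows-rowStep [] _ []         zero    = idle []
bumpRows-rowStep [] _ []         (suc k) = idle []
bumpRows-rowStep [] _ (sr ∷ _)   zero    = idle sr
bumpRows-rowStep [] _ (_ ∷ sP)   (suc k) = idle (rowAt-sorted sP k)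
-- A new bottom row starts here. Inserting into an empty row bumps nothing, in agreement with
-- `bumped` being empty past the last row.
bumpRows-rowStep (s ∷ S) ss []   zero    = subst (RowStep [] _ _) (RowStep.from-empty step refl) step
  where step = rowStep ss [] (insWord-insert (s ∷ S) [])
bumpRows-rowStep (s ∷ S) ss []   (suc k) = idle []
bumpRows-rowStep (s ∷ S) {row ∷ P} ss (sr ∷ sP) zero =
  subst (RowStep row _ _) (sym (targets-values (proj₂ (insWord (s ∷ S) row)) row))
        (rowStep ss sr (insWord-insert (s ∷ S) row))
bumpRows-rowStep (s ∷ S) {row ∷ P} ss (sr ∷ sP) (suc k) = bumpRows-rowStep (targets bs row)
  (subst Sorted (sym (targets-values bs row)) (RowStep.sorted-bumped step)) sP k
  where
  bs   = proj₂ (insWord (s ∷ S) row)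
  step = rowStep ss sr (insWord-insert (s ∷ S) row)

-- Depth functions of a sequence of rows

-- The reading word of the first k rows, row k first.
rows : (ℕ → List ℕ) → ℕ → (ℕ → ℕ) → ℕ → ℕ
rows R zero    f = f
rows R (suc k) f = rows R k (act (R k) f)

-- `depth R k v` is the lds of the letters at least `v` in the reading word of the first `k` rows.
depth : (ℕ → List ℕ) → ℕ → ℕ → ℕ
depth R k = rows R k zeros

act-suc : ∀ x {f} → act x (suc ∘ f) ≗ suc ∘ act x f
act-suc []      v = refl
act-suc (a ∷ x) v = trans (act-cong x (ins-suc a) v) (act-suc x v)
  where
  ins-suc : ∀ a {f} → ins a (suc ∘ f) ≗ suc ∘ ins a f
  ins-suc a v with v ≤? a
  ... | yes _ = refl
  ... | no _  = refl

-- A strictly decreasing sequence meets a weakly increasing row at most once.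
act-sorted : ∀ {r} → Sorted r → ∀ v → act r zeros v ≤ 1
act-sorted sr = go sr (λ _ → z≤n) (All.universal (λ _ → refl) _)
  where
  -- Generalised over the function read so far: it vanishes at `suc x` for each remaining letter
  -- `x`, so no letter can extend an earlier one.
  go : ∀ {r g} → Sorted r → (∀ v → g v ≤ 1) → All (λ x → g (suc x) ≡ 0) r → ∀ v → act r g v ≤ 1
  go [] g≤1 _ = g≤1
  go {a ∷ r} {g} (a≤r ∷ sr) g≤1 (ga≡0 ∷ gr≡0) = go sr g′≤1
    (All.zipWith (λ (a≤x , gx≡0) → trans (ins-> (s≤s a≤x)) gx≡0) (a≤r , gr≡0))
    where
    g′≤1 : ∀ v → ins a g v ≤ 1
    g′≤1 v with v ≤? a
    ... | yes _ = ⊔-lub (g≤1 v) (s≤s (≤-reflexive ga≡0))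
    ... | no _  = g≤1 v

sorted-max : ∀ {a x} → Sorted (a ∷ x) → ∃[ m ] m ∈ a ∷ x × All (_≤ m) (a ∷ x)
sorted-max {x = []} _ = _ , here refl , ≤-refl ∷ []
sorted-max {x = _ ∷ _} ((a≤b ∷ _) ∷ sx) with sorted-max sx
... | m , m∈x , x≤m@(b≤m ∷ _) = m , there m∈x , ≤-trans a≤b b≤m ∷ x≤m

-- On a sorted row with maximum `m`, the action turns `zeros` into the indicator of `v ≤ m`.
act-zeros : ∀ {x y m} → Sorted x → Sorted y → m ∈ x → m ∈ y → All (_≤ m) x → All (_≤ m) y →
            act x zeros ≗ act y zeros
act-zeros {x} {y} {m} sx sy m∈x m∈y x≤m y≤m v with v ≤? m
... | yes v≤m = trans (is-1 sx m∈x) (sym (is-1 sy m∈y))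
  where
  is-1 : ∀ {x} → Sorted x → m ∈ x → act x zeros v ≡ 1
  is-1 sx m∈x = ≤-antisym (act-sorted sx v) (act-∈ zeros (λ _ → z≤n) m∈x v≤m)
... | no v≰m = trans (act-beyond zeros (below-v x≤m)) (sym (act-beyond zeros (below-v y≤m)))
  where
  below-v : ∀ {x} → All (_≤ m) x → All (_< v) x
  below-v = All.map (λ x≤m → ≤-<-trans x≤m (≰⇒> v≰m))

rows-cong : ∀ R k {f g} → f ≗ g → rows R k f ≗ rows R k g
rows-cong R zero    f≗g = f≗g
rows-cong R (suc k) f≗g = rows-cong R k (act-cong (R k) f≗g)

rows-mono : ∀ R k {f g} → f ≼ g → rows R k f ≼ rows R k g
rows-mono R zero    f≼g = f≼g
rows-mono R (suc k) f≼g = rows-mono R k (act-mono (R k) f≼g)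

rows-antitone : ∀ R k {f} → Antitone f → Antitone (rows R k f)
rows-antitone R zero    anti = anti
rows-antitone R (suc k) anti = rows-antitone R k (act-antitone (R k) anti)

rows-suc : ∀ R k {f} → rows R k (suc ∘ f) ≗ suc ∘ rows R k f
rows-suc R zero    v = refl
rows-suc R (suc k) v = trans (rows-cong R k (act-suc (R k)) v) (rows-suc R k v)

depth-antitone : ∀ R k → Antitone (depth R k)
depth-antitone R k = rows-antitone R k (λ _ → z≤n)

module _ {R : ℕ → List ℕ} (sorted : ∀ k → Sorted (R k)) where

  depth-suc : ∀ k v → depth R (suc k) v ≤ suc (depth R k v)
  depth-suc k v = ≤-trans (rows-mono R k (act-sorted (sorted k)) v) (≤-reflexive (rows-suc R k v))

  depth-≤ : ∀ k v → depth R k v ≤ k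
  depth-≤ zero    v = z≤n
  depth-≤ (suc k) v = ≤-trans (depth-suc k v) (s≤s (depth-≤ k v))

  -- Each further row adds at most 1 to the depth. The additive form avoids truncated subtraction.
  depth-lipschitz : ∀ {k l} v → k ≤ l → depth R l v + k ≤ depth R k v + l
  depth-lipschitz {k} v k≤l with m≤n⇒∃[o]m+o≡n k≤l
  ... | o , refl = go o
    where
    go : ∀ o → depth R (k + o) v + k ≤ depth R k v + (k + o)
    go zero    = ≤-reflexive (cong₂ (λ m n → depth R m v + n) (+-identityʳ k) (sym (+-identityʳ k)))
    go (suc o) rewrite +-suc k o | +-suc (depth R k v) (k + o) =
      ≤-trans (+-monoˡ-≤ k (depth-suc (k + o) v)) (s≤s (go o))

-- A dichotomy preserved by the action

private
  -- A maximum is attained by one of its arguments, so this pointwise dichotomy survives every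
  -- `ins`. It carries a comparison made at a stuck row up through the rows above it.
  Between : (f g h : ℕ → ℕ) → Set
  Between f g h = ∀ v → g v ≤ f v ⊎ suc (g v) ≤ h v

  ins-between : ∀ a {f g h} → Between f g h → Between (ins a f) (ins a g) (ins a h)
  ins-between a {f} {g} {h} btw v with v ≤? a
  ... | no _ = btw v
  ... | yes _ with ⊔-sel (g v) (suc (g (suc a)))
  ...   | inj₁ eq rewrite eq with btw v
  ...     | inj₁ g≤f = inj₁ (m≤n⇒m≤n⊔o _ g≤f)
  ...     | inj₂ g<h = inj₂ (m≤n⇒m≤n⊔o _ g<h)
  ins-between a {f} {g} {h} btw v | yes _ | inj₂ eq rewrite eq with btw (suc a)
  ...     | inj₁ g≤f = inj₁ (m≤n⇒m≤o⊔n (f v) (s≤s g≤f))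
  ...     | inj₂ g<h = inj₂ (m≤n⇒m≤o⊔n (h v) (s≤s g<h))

  act-between : ∀ x {f g h} → Between f g h → Between (act x f) (act x g) (act x h)
  act-between []      btw = btw
  act-between (a ∷ x) btw = act-between x (ins-between a btw)

  rows-between : ∀ R k {f g h} → Between f g h → Between (rows R k f) (rows R k g) (rows R k h)
  rows-between R zero    btw = btw
  rows-between R (suc k) btw = rows-between R k (act-between (R k) btw)

-- Growth chains and the invariant

-- Chain len i t k m: there are m times i < t₁ < ⋯ < tₘ ≤ t and rows k₁ < ⋯ < kₘ = k (counted from 1)
-- such that row kⱼ gets longer at time tⱼ.
data Chain (len : ℕ → ℕ → ℕ) (i : ℕ) : ℕ → ℕ → ℕ → Set where
  start : Chain len i i 0 0
  stay  : ∀ {t k m} → Chain len i t k m → Chain len i (suc t) k m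
  grow  : ∀ {t k l m} → k ≤ l → len t l < len (suc t) l → Chain len i t k m →
          Chain len i (suc t) (suc l) (suc m)

-- n v = max { m + depth R k v ∸ k | C k m }, written without subtraction.
record Balanced (C : ℕ → ℕ → Set) (R : ℕ → List ℕ) (n : ℕ → ℕ) : Set where
  field
    upper    : ∀ {k m} → C k m → ∀ v → m + depth R k v ≤ n v + k
    full     : ∀ {k m} → C k m → k ≤ depth R k 0
    attained : ∀ v → ∃[ k ] ∃[ m ] C k m × n v + k ≤ m + depth R k v

private
  ins-shift : ∀ a {g h m k} → (∀ v → m + g v ≤ h v + k) → ∀ v → m + ins a g v ≤ ins a h v + k
  ins-shift a {g} {h} {m} {k} le v with v ≤? a
  ... | no _ = le v
  ... | yes _ = begin
    m + (g v ⊔ suc (g (suc a)))          ≡⟨ +-distribˡ-⊔ m (g v) _ ⟩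
    (m + g v) ⊔ (m + suc (g (suc a)))    ≡⟨ cong ((m + g v) ⊔_) (+-suc m _) ⟩
    (m + g v) ⊔ suc (m + g (suc a))      ≤⟨ ⊔-mono-≤ (le v) (s≤s (le (suc a))) ⟩
    (h v + k) ⊔ (suc (h (suc a)) + k)    ≡⟨ +-distribʳ-⊔ k (h v) _ ⟨
    (h v ⊔ suc (h (suc a))) + k          ∎
    where open ≤-Reasoning

-- One insertion preserves the invariant

-- `R` and `R′` are the rows before and after the insertion of `a`, and `σ k` is the set entering
-- row `k`. The bound `size` on the nonempty rows ends the bumping.
module Step
  {a : ℕ} {R R′ σ : ℕ → List ℕ}
  (σ₀ : σ 0 ≡ a ∷ [])
  (sorted : ∀ k → Sorted (R k))
  (step : ∀ k → RowStep (R k) (σ k) (R′ k) (σ (suc k)))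
  (size : ℕ) (beyond : ∀ {k} → size ≤ k → R k ≡ [])
  where

  private module S k = RowStep (step k)

  sorted′ : ∀ k → Sorted (R′ k)
  sorted′ k = S.sorted-row k

  σ-sorted : ∀ k → Sorted (σ k)
  σ-sorted zero    = subst Sorted (sym σ₀) ([] ∷ [])
  σ-sorted (suc k) = S.sorted-bumped k

  σ-stops : ∀ {k} → size ≤ k → σ (suc k) ≡ []
  σ-stops {k} size≤k = S.from-empty k (beyond size≤k)

  Grown : ℕ → Set
  Grown k = length (R k) < length (R′ k)

  -- Passing through the rows from the top, the letter `a` read after them turns into the set `σ k`
  -- read before them.
  exchange : ∀ k {f} → Antitone f → ins a (rows R k f) ≗ rows R′ k (act (σ k) f)
  exchange zero        anti v = cong (λ s → act s _ v) (sym σ₀)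
  exchange (suc k) {f} anti v = trans (exchange k (act-antitone (R k) anti) v)
    (rows-cong R′ k (S.exchange k anti) v)

  exchange₀ : ∀ k → ins a (depth R k) ≗ rows R′ k (act (σ k) zeros)
  exchange₀ k = exchange k (λ _ → z≤n)

  depth′-≤ : ∀ k v → depth R′ k v ≤ ins a (depth R k) v
  depth′-≤ k v = ≤-trans (rows-mono R′ k (λ _ → z≤n) v) (≤-reflexive (sym (exchange₀ k v)))

  depth′-stopped : ∀ {k} → σ k ≡ [] → depth R′ k ≗ ins a (depth R k)
  depth′-stopped {k} σk≡[] v = sym (trans (exchange₀ k v) (cong (λ s → rows R′ k (act s zeros) v) σk≡[]))

  -- Every bumped value was bumped by a smaller inserted one, so the bumping reaching level k leaves a
  -- strictly increasing chain a < ⋯ < z, one entry in each of the first k rows.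
  bump-chain : ∀ k {z g} → z ∈ σ k → Antitone g → k + g z ≤ rows R′ k g a
  bump-chain zero z∈ anti with subst (_ ∈_) σ₀ z∈
  ... | here refl = ≤-refl
  bump-chain (suc k) {z} {g} z∈ anti with S.below k z∈
  ... | b , b∈ , b<z = begin
    suc k + g z               ≡⟨ +-suc k (g z) ⟨
    k + suc (g z)             ≤⟨ +-monoʳ-≤ k (s≤s (anti b<z)) ⟩
    k + suc (g (suc b))       ≤⟨ +-monoʳ-≤ k (act-∈ g anti (S.inserted k b∈) ≤-refl) ⟩
    k + act (R′ k) g b        ≤⟨ bump-chain k b∈ (act-antitone (R′ k) anti) ⟩
    rows R′ (suc k) g a       ∎
    where open ≤-Reasoning

  depth′-full : ∀ k {z} → z ∈ σ k → ∀ {v} → v ≤ a → k ≤ depth R′ k v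
  depth′-full k z∈ v≤a = ≤-trans (≤-reflexive (sym (+-identityʳ k)))
    (≤-trans (bump-chain k z∈ (λ _ → z≤n)) (depth-antitone R′ k v≤a))

  -- The chain of `bump-chain` has one entry in each of the first `k` rows, and `z` itself, now an
  -- entry of row `k`, supplies one more.
  depth′-full-suc : ∀ k {z} → z ∈ σ k → ∀ {v} → v ≤ a → suc k ≤ depth R′ (suc k) v
  depth′-full-suc k {z} z∈ v≤a = begin
    suc k                           ≡⟨ +-comm 1 k ⟩
    k + 1                           ≤⟨ +-monoʳ-≤ k (act-∈ zeros (λ _ → z≤n) (S.inserted k z∈) ≤-refl) ⟩
    k + act (R′ k) zeros z          ≤⟨ bump-chain k z∈ (act-antitone (R′ k) (λ _ → z≤n)) ⟩
    depth R′ (suc k) a              ≤⟨ depth-antitone R′ (suc k) v≤a ⟩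
    depth R′ (suc k) _              ∎
    where open ≤-Reasoning

  grown-nonempty : ∀ {k} → Grown k → ∃[ z ] z ∈ σ k
  grown-nonempty {k} g with σ k | S.quiet k
  ... | []    | q = ⊥-elim (<-irrefl (cong length (sym (q refl))) g)
  ... | z ∷ _ | _ = z , here refl

  σ-max : ∀ k {z} → z ∈ σ k → ∃[ m ] m ∈ σ k × All (_≤ m) (σ k)
  σ-max k z∈ with σ k | σ-sorted k
  ... | _ ∷ _ | ss = sorted-max ss

  -- A grown row ends in the largest value pushed into it, so the row and the pushed set act alike
  -- on `zeros`.
  depth′-grown : ∀ {k} → Grown k → depth R′ (suc k) ≗ ins a (depth R k)
  depth′-grown {k} g v with σ-max k (proj₂ (grown-nonempty g))
  ... | m , m∈ , σ≤m = trans
    (rows-cong R′ k (act-zeros (sorted′ k) (σ-sorted k) (S.inserted k m∈) m∈ (S.grown k g σ≤m) σ≤m) v)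
    (sym (exchange₀ k v))

  -- A stuck row bumps a value above all of `σ k`. Wherever `σ k` turns `zeros` into 1, the bumped
  -- set followed by the new row `k` gives at least 2, and `rows-between` carries this upwards.
  depth-stuck : ∀ {k z} → z ∈ σ k → ¬ Grown k → ∀ v →
                ins a (depth R k) v ≤ depth R′ k v ⊎ suc (ins a (depth R k) v) ≤ ins a (depth R (suc k)) v
  depth-stuck {k} z∈ ¬g v with σ-max k z∈
  ... | m , m∈ , σ≤m with S.stuck k m∈ (≮⇒≥ ¬g)
  ... | z′ , z′∈ , σ<z′ rewrite exchange₀ k v | exchange₀ (suc k) v = rows-between R′ k between v
    where
    m<z′ : m < z′
    m<z′ = All.lookup σ<z′ m∈
    between : ∀ v → act (σ k) zeros v ≤ 0 ⊎
                    suc (act (σ k) zeros v) ≤ act (R′ k) (act (σ (suc k)) zeros) v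
    between v with v ≤? m
    ... | no v≰m = inj₁ (≤-reflexive (act-beyond zeros (All.map (λ x≤m → ≤-<-trans x≤m (≰⇒> v≰m)) σ≤m)))
    ... | yes v≤m = inj₂ (≤-trans (s≤s (act-sorted (σ-sorted k) v)) (≤-trans
      (s≤s (act-∈ zeros (λ _ → z≤n) z′∈ m<z′))
      (act-∈ _ (act-antitone (σ (suc k)) (λ _ → z≤n)) (S.inserted k m∈) v≤m)))

  -- A nonempty set entering a row lengthens it or bumps a nonempty set out of it, and nothing is
  -- bumped out of the empty rows from `size` on.
  next-grown : ∀ fuel l {z} → suc size ≤ l + fuel → z ∈ σ l → ∃[ l′ ] l ≤ l′ × Grown l′
  next-grown zero l h z∈ with l | subst (suc size ≤_) (+-identityʳ l) h
  ... | suc l | s≤s size≤l with subst (_ ∈_) (σ-stops size≤l) z∈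
  ...   | ()
  next-grown (suc fuel) l h z∈ with length (R l) <? length (R′ l)
  ... | yes g = l , ≤-refl , g
  ... | no ¬g with S.stuck l z∈ (≮⇒≥ ¬g)
  ...   | _ , z′∈ , _ with next-grown fuel (suc l) (subst (suc size ≤_) (+-suc l fuel) h) z′∈
  ...     | l′ , l<l′ , g = l′ , <⇒≤ l<l′ , g

  -- Going down from row k to the next row that grows, each stuck row either adds 1 to the depth or shows
  -- that depth R k v has not dropped.
  search : ∀ {v k} fuel l {z} → a < v → k ≤ l → suc size ≤ l + fuel → z ∈ σ l →
           depth R k v + l ≤ depth R l v + k →
           depth R k v ≤ depth R′ k v ⊎ ∃[ l′ ] k ≤ l′ × Grown l′ × depth R k v + l′ ≤ depth R l′ v + k
  search zero l _ _ h z∈ _ with l | subst (suc size ≤_) (+-identityʳ l) h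
  ... | suc l | s≤s size≤l with subst (_ ∈_) (σ-stops size≤l) z∈
  ...   | ()
  search {v} {k} (suc fuel) l a<v k≤l h z∈ inv with length (R l) <? length (R′ l)
  ... | yes g = inj₂ (l , k≤l , g , inv)
  ... | no ¬g with depth-stuck z∈ ¬g v
  ...   | inj₁ kept = inj₁ (+-cancelʳ-≤ l _ _ (begin
    depth R k v + l             ≤⟨ inv ⟩
    depth R l v + k             ≡⟨ cong (_+ k) (ins-> a<v) ⟨
    ins a (depth R l) v + k     ≤⟨ +-monoˡ-≤ k kept ⟩
    depth R′ l v + k            ≤⟨ depth-lipschitz sorted′ v k≤l ⟩
    depth R′ k v + l            ∎))
    where open ≤-Reasoning
  -- The gain of 1 in depth pays for the step from `l` to `suc l`.
  ...   | inj₂ deeper with S.stuck l z∈ (≮⇒≥ ¬g)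
  ...     | _ , z′∈ , _ = search fuel (suc l) a<v (m≤n⇒m≤1+n k≤l) (subst (suc size ≤_) (+-suc l fuel) h) z′∈ (begin
    depth R k v + suc l         ≡⟨ +-suc (depth R k v) l ⟩
    suc (depth R k v + l)       ≤⟨ s≤s inv ⟩
    suc (depth R l v) + k       ≤⟨ +-monoˡ-≤ k (subst₂ (λ m n → suc m ≤ n) (ins-> a<v) (ins-> a<v) deeper) ⟩
    depth R (suc l) v + k       ∎)
    where open ≤-Reasoning

  -- An old chain persists or is extended by a growing row. `upper` rests on comparing depths before
  -- and after, `full` on the chain of bumps, and `attained` on the next row that grows once the
  -- bumping gets past the first `k` rows.
  advance : ∀ {len i t n} → (∀ l → len t l ≡ length (R l)) → (∀ l → len (suc t) l ≡ length (R′ l)) →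
            Balanced (Chain len i t) R n → Balanced (Chain len i (suc t)) R′ (ins a n)
  advance {len} {i} {t} {n} len-R len-R′ bal = record { upper = upper′ ; full = full′ ; attained = attained′ }
    where
    open Balanced bal
    open ≤-Reasoning

    grown : ∀ {l} → len t l < len (suc t) l → Grown l
    grown {l} = subst₂ _<_ (len-R l) (len-R′ l)

    ungrown : ∀ {l} → Grown l → len t l < len (suc t) l
    ungrown {l} = subst₂ _<_ (sym (len-R l)) (sym (len-R′ l))

    upper′ : ∀ {k m} → Chain len i (suc t) k m → ∀ v → m + depth R′ k v ≤ ins a n v + k
    upper′ start v = +-monoˡ-≤ 0 z≤n
    upper′ {k} {m} (stay c) v =
      ≤-trans (+-monoʳ-≤ m (depth′-≤ k v)) (ins-shift a {depth R k} (upper c) v)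
    upper′ (grow {k = k} {l} {m} k≤l g c) v = begin
      suc m + depth R′ (suc l) v     ≡⟨ cong (suc m +_) (depth′-grown (grown g) v) ⟩
      suc m + ins a (depth R l) v    ≤⟨ s≤s (ins-shift a {depth R l} {n} {m} {l} upper-l v) ⟩
      suc (ins a n v + l)            ≡⟨ +-suc _ l ⟨
      ins a n v + suc l              ∎
      where
      -- By the Lipschitz bound, the estimate at the old end `k` passes to every later `l`.
      upper-l : ∀ v → m + depth R l v ≤ n v + l
      upper-l v = +-cancelʳ-≤ k _ _ (begin
        m + depth R l v + k          ≡⟨ +-assoc m _ k ⟩
        m + (depth R l v + k)        ≤⟨ +-monoʳ-≤ m (depth-lipschitz sorted v k≤l) ⟩
        m + (depth R k v + l)        ≡⟨ +-assoc m _ l ⟨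
        m + depth R k v + l          ≤⟨ +-monoˡ-≤ l (upper c v) ⟩
        n v + k + l                  ≡⟨ +-assoc (n v) k l ⟩
        n v + (k + l)                ≡⟨ cong (n v +_) (+-comm k l) ⟩
        n v + (l + k)                ≡⟨ +-assoc (n v) l k ⟨
        n v + l + k                  ∎)

    full′ : ∀ {k m} → Chain len i (suc t) k m → k ≤ depth R′ k 0
    full′ start = z≤n
    full′ {k} (stay c) with σ k in eq
    ... | []    = ≤-trans (full c) (≤-trans (ins-increasing a (depth R k) 0)
                    (≤-reflexive (sym (depth′-stopped eq 0))))
    ... | z ∷ _ = depth′-full k {z} (subst (z ∈_) (sym eq) (here refl)) z≤n
    full′ (grow {l = l} _ g _) = depth′-full-suc l (proj₂ (grown-nonempty (grown g))) z≤n

    keep : ∀ {v w k m} → Chain len i t k m → n w + k ≤ m + depth R k w → depth R k w ≤ depth R′ k v →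
           ∃[ k ] ∃[ m ] Chain len i (suc t) k m × n w + k ≤ m + depth R′ k v
    keep {k = k} {m} c le d = k , m , stay c , ≤-trans le (+-monoʳ-≤ m d)

    attained′ : ∀ v → ∃[ k ] ∃[ m ] Chain len i (suc t) k m × ins a n v + k ≤ m + depth R′ k v
    attained′ v with <-≤-connex a v
    -- The letter `a` lies below `v` and leaves `n v` unchanged: the old chain still serves, or is
    -- extended to offset a loss of depth.
    attained′ v | inj₁ a<v rewrite ins-> {a} {n} a<v with attained v
    ... | k , m , c , le with σ k in eq
    ...   | [] = keep c le (≤-reflexive (trans (sym (ins-> a<v)) (sym (depth′-stopped eq v))))
    ...   | z ∷ _ with search (suc size) k {z} a<v ≤-refl (m≤n+m (suc size) k)
                         (subst (z ∈_) (sym eq) (here refl)) ≤-refl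
    ...     | inj₁ d = keep c le d
    ...     | inj₂ (l , k≤l , g , d) = suc l , suc m , grow k≤l (ungrown g) c , (begin
      n v + suc l                    ≡⟨ +-suc (n v) l ⟩
      suc (n v + l)                  ≤⟨ s≤s (+-cancelʳ-≤ k _ _ shifted) ⟩
      suc m + depth R l v            ≡⟨ cong (suc m +_) (trans (depth′-grown g v) (ins-> a<v)) ⟨
      suc m + depth R′ (suc l) v     ∎)
      where
      shifted : n v + l + k ≤ m + depth R l v + k
      shifted = begin
        n v + l + k                  ≡⟨ +-assoc (n v) l k ⟩
        n v + (l + k)                ≡⟨ cong (n v +_) (+-comm l k) ⟩
        n v + (k + l)                ≡⟨ +-assoc (n v) k l ⟨
        n v + k + l                  ≤⟨ +-monoˡ-≤ l le ⟩
        m + depth R k v + l          ≡⟨ +-assoc m _ l ⟩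
        m + (depth R k v + l)        ≤⟨ +-monoʳ-≤ m d ⟩
        m + (depth R l v + k)        ≡⟨ +-assoc m _ k ⟨
        m + depth R l v + k          ∎
    attained′ v | inj₂ v≤a rewrite ins-≤ {a} {n} v≤a with ⊔-sel (n v) (suc (n (suc a)))
    -- The old value wins and its chain stays: the depth cannot drop, being at least `k` once the
    -- bumping reaches row `k`.
    ... | inj₁ max rewrite max with attained v
    ...   | k , m , c , le with σ k in eq
    ...     | [] = keep c le (≤-trans (ins-increasing a (depth R k) v) (≤-reflexive (sym (depth′-stopped eq v))))
    ...     | z ∷ _ = keep c le (≤-trans (depth-≤ sorted k v)
                        (depth′-full k {z} (subst (z ∈_) (sym eq) (here refl)) v≤a))
    -- The best sequence ends in `a`, so the chain for `suc a` is used. Either `a` raises the depth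
    -- of its `k` rows, or the bumping gets past them and a growing row extends the chain.
    attained′ v | inj₂ v≤a | inj₂ max rewrite max with attained (suc a)
    ...   | k , m , c , le with σ k in eq
    ...     | [] = k , m , stay c , (begin
      suc (n (suc a) + k)                ≤⟨ s≤s le ⟩
      suc (m + depth R k (suc a))        ≡⟨ +-suc m _ ⟨
      m + suc (depth R k (suc a))        ≤⟨ +-monoʳ-≤ m (ins-step v≤a) ⟩
      m + ins a (depth R k) v            ≡⟨ cong (m +_) (depth′-stopped eq v) ⟨
      m + depth R′ k v                   ∎)
    ...     | z ∷ _ with next-grown (suc size) k {z} (m≤n+m (suc size) k) (subst (z ∈_) (sym eq) (here refl))
    ...       | l , k≤l , g = suc l , suc m , grow k≤l (ungrown g) c ,
      s≤s (+-mono-≤ n≤m (depth′-full-suc l (proj₂ (grown-nonempty g)) v≤a))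
      where
      n≤m : n (suc a) ≤ m
      n≤m = +-cancelʳ-≤ k _ _ (≤-trans le (+-monoʳ-≤ m (depth-≤ sorted k (suc a))))

-- The lds computed by the action

private
  score : List ℕ → ℕ
  score y = if strictDec y then length y else 0

  best : List (List ℕ) → ℕ
  best = foldr (λ y m → score y ⊔ m) 0

  best-≥ : ∀ {y ys} → y ∈ ys → T (strictDec y) → length y ≤ best ys
  best-≥ {y} (here refl) dec with strictDec y
  ... | true = m≤m⊔n _ _
  best-≥ {ys = y ∷ _} (there y∈) dec = m≤n⇒m≤o⊔n (score y) (best-≥ y∈ dec)

  best-≤ : ∀ ys {b} → (∀ {y} → y ∈ ys → T (strictDec y) → length y ≤ b) → best ys ≤ b
  best-≤ []       _ = z≤n
  best-≤ (y ∷ ys) {b} h = ⊔-lub score≤ (best-≤ ys (h ∘ there))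
    where
    score≤ : score y ≤ b
    score≤ with strictDec y | h (here refl)
    ... | true  | h′ = h′ _
    ... | false | _  = z≤n

  strictDec-∷ : ∀ {a h y} → T (strictDec (a ∷ h ∷ y)) → h < a × T (strictDec (h ∷ y))
  strictDec-∷ {a} {h} t with Equivalence.to T-∧ t
  ... | h<a , dec = <ᵇ⇒< h a h<a , dec

  -- The function `f` accounts for letters read earlier; those continued by the subsequence must
  -- exceed its first letter, whence `f (suc h)`.
  dec-bound : ∀ x {h y} f → h ∷ y ∈ subseqs x → T (strictDec (h ∷ y)) →
              suc (length y) + f (suc h) ≤ act x f 0
  dec-bound [] f (here ())
  dec-bound [] f (there ())
  dec-bound (a ∷ x) {h} {y} f y∈ dec with ∈-++⁻ (map (a ∷_) (subseqs x)) y∈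
  ... | inj₂ y∈x = ≤-trans (+-monoʳ-≤ (suc (length y)) (ins-increasing a f (suc h)))
                           (dec-bound x (ins a f) y∈x dec)
  ... | inj₁ y∈ax with ∈-map⁻ (a ∷_) y∈ax
  ...   | [] , _ , refl = ≤-trans (ins-step {a} {f} z≤n) (act-increasing x (ins a f) 0)
  ...   | h′ ∷ y′ , y∈x , refl with strictDec-∷ {y = y′} dec
  ...     | h′<a , dec′ = begin
    suc (suc (length y′)) + f (suc a)        ≡⟨ +-suc (suc (length y′)) _ ⟨
    suc (length y′) + suc (f (suc a))        ≤⟨ +-monoʳ-≤ (suc (length y′)) (ins-step {a} {f} h′<a) ⟩
    suc (length y′) + ins a f (suc h′)       ≤⟨ dec-bound x (ins a f) y∈x dec′ ⟩
    act x (ins a f) 0                        ∎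
    where open ≤-Reasoning

  -- Tracing which argument attains each maximum exhibits either no letter of `x` or a subsequence
  -- of `x` responsible for the value.
  dec-attained : ∀ x f v → act x f v ≤ f v ⊎
    ∃[ h ] ∃[ y ] h ∷ y ∈ subseqs x × T (strictDec (h ∷ y)) × act x f v ≤ suc (length y) + f (suc h)
  dec-attained []      f v = inj₁ ≤-refl
  dec-attained (a ∷ x) f v with dec-attained x (ins a f) v
  ... | inj₁ le with v ≤? a
  ...   | no _ = inj₁ le
  ...   | yes _ with ⊔-sel (f v) (suc (f (suc a)))
  ...     | inj₁ eq = inj₁ (≤-trans le (≤-reflexive eq))
  ...     | inj₂ eq = inj₂ (a , [] , ∈-++⁺ˡ (∈-map⁺ (a ∷_) (empty∈ x)) , _ , ≤-trans le (≤-reflexive eq))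
    where
    empty∈ : ∀ x → [] ∈ subseqs x
    empty∈ []      = here refl
    empty∈ (b ∷ x) = ∈-++⁺ʳ (map (b ∷_) (subseqs x)) (empty∈ x)
  -- The letter `a` is put in front when it is what attains `ins a f (suc h)`.
  dec-attained (a ∷ x) f v | inj₂ (h , y , y∈ , dec , le) with suc h ≤? a
  ... | no _ = inj₂ (h , y , ∈-++⁺ʳ (map (a ∷_) (subseqs x)) y∈ , dec , le)
  ... | yes h<a with ⊔-sel (f (suc h)) (suc (f (suc a)))
  ...   | inj₁ eq = inj₂ (h , y , ∈-++⁺ʳ (map (a ∷_) (subseqs x)) y∈ , dec ,
                          subst (λ m → act x (ins a f) v ≤ suc (length y) + m) eq le)
  ...   | inj₂ eq = inj₂ (a , h ∷ y , ∈-++⁺ˡ (∈-map⁺ (a ∷_) y∈) , Equivalence.from T-∧ (<⇒<ᵇ h<a , dec) ,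
                          ≤-trans le (≤-reflexive (trans (cong (suc (length y) +_) eq) (+-suc (suc (length y)) (f (suc a))))))

lds-act : ∀ x → lds x ≡ act x zeros 0
lds-act x = ≤-antisym (best-≤ (subseqs x) bound) attained
  where
  bound : ∀ {y} → y ∈ subseqs x → T (strictDec y) → length y ≤ act x zeros 0
  bound {[]}    _  _   = z≤n
  bound {h ∷ y} y∈ dec = ≤-trans (≤-reflexive (sym (+-identityʳ _))) (dec-bound x zeros y∈ dec)
  attained : act x zeros 0 ≤ lds x
  attained with dec-attained x zeros 0
  ... | inj₁ le = ≤-trans le z≤n
  ... | inj₂ (h , y , y∈ , dec , le) =
    ≤-trans le (≤-trans (≤-reflexive (+-identityʳ _)) (best-≥ y∈ dec))

-- Iterating over a word

bumpRows-All : ∀ S {P} → Sorted (map proj₁ S) → All Sorted P → All Sorted (bumpRows S P)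
bumpRows-All []      _  sP = sP
bumpRows-All (s ∷ S) ss [] = insert-sorted [] (insWord-insert (s ∷ S) []) ∷ []
bumpRows-All (s ∷ S) {row ∷ P} ss (sr ∷ sP) = RowStep.sorted-row step ∷
  bumpRows-All (targets bs row) (subst Sorted (sym (targets-values bs row)) (RowStep.sorted-bumped step)) sP
  where
  bs   = proj₂ (insWord (s ∷ S) row)
  step = rowStep ss sr (insWord-insert (s ∷ S) row)

iins-All : ∀ {P} a → All Sorted P → All Sorted (iins P a)
iins-All a sP = bumpRows-All _ ([] ∷ []) sP

lenAt : Tableau → ℕ → ℕ
lenAt P k = length (rowAt k P)

-- The function `len` is abstract and tied to the tableaux only from time `t` to `t + length x`, so
-- that it can later be read off `𝒬`.
balanced-run : ∀ {len i t n P} x → All Sorted P →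
  (∀ s k → s ≤ length x → len (t + s) k ≡ lenAt (foldl iins P (take s x)) k) →
  Balanced (Chain len i t) (λ k → rowAt k P) n →
  Balanced (Chain len i (t + length x)) (λ k → rowAt k (foldl iins P x)) (act x n)
balanced-run {len} {i} {t} {n} {P} [] sP lens bal =
  subst (λ t → Balanced (Chain len i t) (λ k → rowAt k P) n) (sym (+-identityʳ t)) bal
balanced-run {len} {i} {t} {n} {P} (a ∷ x) sP lens bal =
  subst (λ t → Balanced (Chain len i t) (λ k → rowAt k (foldl iins (iins P a) x)) (act x (ins a n)))
    (sym (+-suc t (length x)))
    (balanced-run x (iins-All a sP) (λ s k s≤ → trans (cong (λ t → len t k) (sym (+-suc t s))) (lens (suc s) k (s≤s s≤)))
      (Step.advance refl (rowAt-sorted sP) (bumpRows-rowStep ((a , firstRowLength P) ∷ []) ([] ∷ []) sP)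
        (length P) (rowAt-beyond P)
        (λ k → trans (cong (λ t → len t k) (sym (+-identityʳ t))) (lens 0 k z≤n))
        (λ k → trans (cong (λ t → len t k) (sym (+-comm t 1))) (lens 1 k (s≤s z≤n))) bal))

-- Time `i` admits only the empty chain, and with `k = 0` no row contributes; hence `R` may be any
-- tableau reached before the factor begins.
balanced-start : ∀ {len i R} → Balanced (Chain len i i) R zeros
balanced-start {len} {i} = record
  { upper    = λ { start v → z≤n ; (stay c) v → ⊥-elim (late c) ; (grow _ _ c) v → ⊥-elim (late c) }
  ; full     = λ { start → z≤n ; (stay c) → ⊥-elim (late c) ; (grow _ _ c) → ⊥-elim (late c) }
  ; attained = λ v → 0 , 0 , start , z≤n
  }
  where
  i≤ : ∀ {i t k m} → Chain len i t k m → i ≤ t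
  i≤ start        = ≤-refl
  i≤ (stay c)     = m≤n⇒m≤1+n (i≤ c)
  i≤ (grow _ _ c) = m≤n⇒m≤1+n (i≤ c)
  late : ∀ {t k m} → ¬ Chain len (suc t) t k m
  late c = <-irrefl refl (i≤ c)

run-All : ∀ {P} x → All Sorted P → All Sorted (foldl iins P x)
run-All []      sP = sP
run-All (a ∷ x) sP = run-All x (iins-All a sP)

-- At `v = 0` the depth of the first `k` rows of any chain equals `k`, by `full` and `depth-≤`. So
-- `n 0` is the largest `m` and is determined by `C`.
balanced-≤ : ∀ {C R R′ n n′} → (∀ k → Sorted (R k)) → Balanced C R n → Balanced C R′ n′ → n 0 ≤ n′ 0
balanced-≤ {R = R} {R′} {n} {n′} sR bal bal′ with Balanced.attained bal 0
... | k , m , c , le = +-cancelʳ-≤ k _ _ (begin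
  n 0 + k              ≤⟨ le ⟩
  m + depth R k 0      ≤⟨ +-monoʳ-≤ m (≤-trans (depth-≤ sR k 0) (Balanced.full bal′ c)) ⟩
  m + depth R′ k 0     ≤⟨ Balanced.upper bal′ c 0 ⟩
  n′ 0 + k             ∎)
  where open ≤-Reasoning

-- Shapes read off the recording tableau

rowAt-addBoxes : ∀ j Q P k → rowAt k (addBoxes j Q (shape P)) ≡
                 rowAt k Q ++ replicate (lenAt P k ∸ lenAt Q k) j
rowAt-addBoxes j []      []      k       = refl
rowAt-addBoxes j []      (r ∷ P) zero    = refl
rowAt-addBoxes j []      (r ∷ P) (suc k) = rowAt-addBoxes j [] P k
rowAt-addBoxes j (q ∷ Q) []      zero    rewrite 0∸n≡0 (length q) = sym (++-identityʳ q)
rowAt-addBoxes j (q ∷ Q) []      (suc k) = rowAt-addBoxes j Q [] k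
rowAt-addBoxes j (q ∷ Q) (r ∷ P) zero    = refl
rowAt-addBoxes j (q ∷ Q) (r ∷ P) (suc k) = rowAt-addBoxes j Q P k

-- Every entry recorded after time `j` exceeds `s`.
record-stable : ∀ w {j s P Q} k → s ≤ j →
  filter (_≤? s) (rowAt k (proj₂ (iRSKfrom j (P , Q) w))) ≡ filter (_≤? s) (rowAt k Q)
record-stable []      k s≤j = refl
record-stable (a ∷ w) {j} {s} {P} {Q} k s≤j = begin
  filter (_≤? s) (rowAt k (proj₂ (iRSKfrom (suc j) (P′ , addBoxes (suc j) Q (shape P′)) w)))
    ≡⟨ record-stable w k (m≤n⇒m≤1+n s≤j) ⟩
  filter (_≤? s) (rowAt k (addBoxes (suc j) Q (shape P′)))
    ≡⟨ cong (filter (_≤? s)) (rowAt-addBoxes (suc j) Q P′ k) ⟩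
  filter (_≤? s) (rowAt k Q ++ new)
    ≡⟨ filter-++ (_≤? s) (rowAt k Q) new ⟩
  filter (_≤? s) (rowAt k Q) ++ filter (_≤? s) new
    ≡⟨ cong (filter (_≤? s) (rowAt k Q) ++_)
         (filter-none (_≤? s) (All.replicate⁺ (lenAt P′ k ∸ lenAt Q k) (<⇒≱ (s≤s s≤j)))) ⟩
  filter (_≤? s) (rowAt k Q) ++ []
    ≡⟨ ++-identityʳ _ ⟩
  filter (_≤? s) (rowAt k Q) ∎
  where
  open ≡-Reasoning
  P′  = iins P a
  new = replicate (lenAt P′ k ∸ lenAt Q k) (suc j)

record-shape : ∀ w {j P Q} t → t ≤ length w → All Sorted P →
  (∀ k → All (_≤ j) (rowAt k Q)) → (∀ k → lenAt Q k ≡ lenAt P k) → ∀ k →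
  length (filter (_≤? (j + t)) (rowAt k (proj₂ (iRSKfrom j (P , Q) w)))) ≡ lenAt (foldl iins P (take t w)) k
record-shape w {j} {P} {Q} zero _ sP Q≤j Q∼P k rewrite +-identityʳ j = begin
  length (filter (_≤? j) (rowAt k (proj₂ (iRSKfrom j (P , Q) w))))  ≡⟨ cong length (record-stable w k ≤-refl) ⟩
  length (filter (_≤? j) (rowAt k Q))                               ≡⟨ cong length (filter-all (_≤? j) (Q≤j k)) ⟩
  lenAt Q k                                                         ≡⟨ Q∼P k ⟩
  lenAt P k                                                         ∎
  where open ≡-Reasoning
record-shape (a ∷ w) {j} {P} {Q} (suc t) (s≤s t≤) sP Q≤j Q∼P k rewrite +-suc j t =
  record-shape w t t≤ (iins-All a sP) Q′≤ Q′∼P′ k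
  where
  P′ = iins P a
  new : ℕ → List ℕ
  new k = replicate (lenAt P′ k ∸ lenAt Q k) (suc j)
  -- Rows never shrink, so the subtraction in `addBoxes` is not truncated.
  Q≤P′ : ∀ k → lenAt Q k ≤ lenAt P′ k
  Q≤P′ k = ≤-trans (≤-reflexive (Q∼P k))
    (RowStep.longer (bumpRows-rowStep ((a , firstRowLength P) ∷ []) ([] ∷ []) sP k))
  Q′≤ : ∀ k → All (_≤ suc j) (rowAt k (addBoxes (suc j) Q (shape P′)))
  Q′≤ k rewrite rowAt-addBoxes (suc j) Q P′ k =
    All.++⁺ (All.map m≤n⇒m≤1+n (Q≤j k)) (All.replicate⁺ (lenAt P′ k ∸ lenAt Q k) ≤-refl)
  Q′∼P′ : ∀ k → lenAt (addBoxes (suc j) Q (shape P′)) k ≡ lenAt P′ k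
  Q′∼P′ k rewrite rowAt-addBoxes (suc j) Q P′ k = begin
    length (rowAt k Q ++ new k)                     ≡⟨ length-++ (rowAt k Q) ⟩
    lenAt Q k + length (new k)                      ≡⟨ cong (lenAt Q k +_) (length-replicate (lenAt P′ k ∸ lenAt Q k)) ⟩
    lenAt Q k + (lenAt P′ k ∸ lenAt Q k)            ≡⟨ m+[n∸m]≡n (Q≤P′ k) ⟩
    lenAt P′ k                                      ∎
    where open ≡-Reasoning

-- Factors and the comparison of two words

-- Row lengths of the sub-tableau of entries ≤ t, that is, of λ⁽ᵗ⁾ when Q = 𝒬 w.
lengths : Tableau → ℕ → ℕ → ℕ
lengths Q t k = length (filter (_≤? t) (rowAt k Q))

take-+ : ∀ m n (x : List ℕ) → take (m + n) x ≡ take m x ++ take n (drop m x)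
take-+ zero    n x       = refl
take-+ (suc m) n []      = sym (take-[] n)
take-+ (suc m) n (a ∷ x) = cong (a ∷_) (take-+ m n x)

-- The run starts from the tableau of the first `i` letters but with `zeros`, so that only letters
-- of the factor count.
factor-balanced : ∀ x i d → i + d ≤ length x →
  Balanced (Chain (lengths (𝒬 x)) i (i + d)) (λ k → rowAt k (foldl iins [] (take (i + d) x)))
           (act (take d (drop i x)) zeros)
factor-balanced x i d i+d≤ = subst₂ (λ e P → Balanced (Chain (lengths (𝒬 x)) i (i + e)) (λ k → rowAt k P) (act y zeros))
  length-y (sym final) (balanced-run y (run-All (take i x) []) agree balanced-start)
  where
  y  = take d (drop i x)
  P₀ = foldl iins [] (take i x)
  length-y : length y ≡ d
  length-y = trans (length-take d (drop i x))
    (m≤n⇒m⊓n≡m (subst (d ≤_) (sym (length-drop i x)) (m+n≤o⇒m≤o∸n d (subst (_≤ length x) (+-comm i d) i+d≤))))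
  prefix : ∀ s → foldl iins [] (take (i + s) x) ≡ foldl iins P₀ (take s (drop i x))
  prefix s = trans (cong (foldl iins []) (take-+ i s x)) (foldl-++ iins [] (take i x) _)
  final : foldl iins [] (take (i + d) x) ≡ foldl iins P₀ y
  final = prefix d
  agree : ∀ s k → s ≤ length y → lengths (𝒬 x) (i + s) k ≡ lenAt (foldl iins P₀ (take s y)) k
  agree s k s≤ = trans
    (record-shape x (i + s) (≤-trans (+-monoʳ-≤ i s≤d) i+d≤) [] (λ _ → []) (λ _ → refl) k)
    (cong (λ P → lenAt P k) (trans (prefix s) (cong (foldl iins P₀) (sym (trans (take-take s d (drop i x))
      (cong (λ e → take e (drop i x)) (m≤n⇒m⊓n≡m s≤d)))))))
    where
    s≤d : s ≤ d
    s≤d = subst (s ≤_) length-y s≤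

theorem4p17 : (n : ℕ) (u w : List ℕ) → length u ≡ n → length w ≡ n →
    All (1 ≤_) u → All (1 ≤_) w → 𝒬 u ≡ 𝒬 w → u ∼cd w
theorem4p17 n u w |u|≡n |w|≡n _ _ Qu≡Qw (suc i) j (s≤s _) i<j j≤|u| = begin
  lds fu          ≡⟨ lds-act fu ⟩
  act fu zeros 0  ≡⟨ ≤-antisym (balanced-≤ (sorted-run u) bal-u bal-w) (balanced-≤ (sorted-run w) bal-w bal-u) ⟩
  act fw zeros 0  ≡⟨ lds-act fw ⟨
  lds fw          ∎
  where
  open ≡-Reasoning
  -- Factors are indexed from 1: position `suc i` comes after `i` letters, and `j ∸ i` letters are
  -- taken.
  d  = j ∸ i
  fu = take d (drop i u)
  fw = take d (drop i w)
  C  = Chain (lengths (𝒬 u)) i (i + d)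
  state : List ℕ → ℕ → List ℕ
  state x k = rowAt k (foldl iins [] (take (i + d) x))
  sorted-run : ∀ x k → Sorted (state x k)
  sorted-run x = rowAt-sorted (run-All (take (i + d) x) [])
  i+d≤|u| : i + d ≤ length u
  i+d≤|u| = subst (_≤ length u) (sym (m+[n∸m]≡n (<⇒≤ i<j))) j≤|u|
  bal-u : Balanced C (state u) (act fu zeros)
  bal-u = factor-balanced u i d i+d≤|u|
  bal-w : Balanced C (state w) (act fw zeros)
  -- Equality of the recording tableaux puts both invariants over the same chains `C`.
  bal-w = subst (λ Q → Balanced (Chain (lengths Q) i (i + d)) (state w) (act fw zeros)) (sym Qu≡Qw)
    (factor-balanced w i d (subst (i + d ≤_) (trans |u|≡n (sym |w|≡n)) i+d≤|u|))
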